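{- Let $r\ge1$ and $s\ge2$. Let $P$ be the pattern of length $s(r+1)$ obtained by concatenating, for $i=1,2,\dots,s$ in order, the blocks $0^r\,i$ (i.e. $P=0^r\,1\,0^r\,2\,0^r\cdots 0^r\,(s-1)\,0^r\,s$), and let $P'$ be the pattern obtained by concatenating, for $i=1,\dots,s$ in order, the blocks $(i-1)^r\,i$ (i.e. $P'=0^r\,1\,1^r\,2\,2^r\cdots(s-1)^r\,s$), where $a^r$ denotes $r$ copies of $a$. Then the consecutive patterns $P$ and $P'$ are super-strongly Wilf equivalent.
   Context: An inversion sequence of length $n$ is an integer sequence $e=e_1e_2\dots e_n$ with $0\le e_i<i$ for all $i$; $\mathbf{I}_n$ denotes the set of these. The reduction of an integer word $w$ is obtained by replacing every occurrence of the $i$-th smallest distinct value of $w$ by $i-1$. For a pattern $p$ of length $m$, $\mathrm{Em}(p,e)$ is the set of positions $i$ such that the reduction of $e_i\dots e_{i+m-1}$ equals $p$. Two patterns are super-strongly Wilf equivalent if $|\{e\in\mathbf{I}_n:\mathrm{Em}(p,e)=T\}|=|\{e\in\mathbf{I}_n:\mathrm{Em}(p',e)=T\}|$ for all $n$ and all $T\subseteq[n]$. -}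

module Defs where

open import Data.Bool.Properties using () renaming (_≟_ to _≟ᵇ_)
open import Data.Fin using (Fin; zero; suc; toℕ)
open import Data.Fin.Subset using (Subset)
open import Data.List using (List; []; _∷_; [_]; _++_; map; concatMap; replicate; upTo; applyUpTo;
  length; take; drop; filter; deduplicate; cartesianProductWith)
open import Data.List.Membership.Propositional using (_∈_)
open import Data.List.Membership.Propositional.Properties
  using (∈-cartesianProductWith⁺; ∈-cartesianProductWith⁻; ∈-upTo⁺; ∈-upTo⁻)
open import Data.List.Properties using (≡-dec)
open import Data.List.Relation.Unary.Any using (here)
open import Data.List.Relation.Unary.Unique.Propositional using (Unique; []; _∷_)
import Data.List.Relation.Unary.All as All
import Data.List.Relation.Unary.Unique.Propositional.Properties as Unique
open import Data.Nat using (ℕ; zero; suc; _+_; _∸_; _<_; _<?_)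
open import Data.Nat.Properties using (_≟_; +-suc)
open import Data.Product using (_×_; _,_)
open import Data.Vec using (Vec; []; _∷_; _∷ʳ_; lookup; tabulate; toList; initLast)
import Data.Vec.Properties as Vec
open import Function.Bundles using (_⇔_; mk⇔)
open import Relation.Binary.PropositionalEquality using (_≡_; refl; sym; subst)
open import Relation.Nullary using (Dec; does)

-- Positions are numbered from 0 by Fin n, so the condition e_i < i on the
-- 1-based position i reads  e_j < j + 1  on the 0-based position j.
IsInversionSequence : ∀ {n} → Vec ℕ n → Set
IsInversionSequence {n} e = (j : Fin n) → lookup e j < suc (toℕ j)

-- The set I_n as a list; that it lists exactly the inversion sequences, each
-- once, is proved below (∈-inversionSequences and inversionSequences-unique).
inversionSequences : (n : ℕ) → List (Vec ℕ n)
inversionSequences zero    = [ [] ]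
inversionSequences (suc n) = cartesianProductWith _∷ʳ_ (inversionSequences n) (upTo (suc n))

private
  BoundedFrom : ∀ {n} → ℕ → Vec ℕ n → Set
  BoundedFrom {n} k e = (j : Fin n) → lookup e j < suc (k + toℕ j)

  snoc⁺ : ∀ {n} k (e : Vec ℕ n) x → BoundedFrom k e → x < suc (k + n) → BoundedFrom k (e ∷ʳ x)
  snoc⁺ k []      x b x< zero    = x<
  snoc⁺ k (y ∷ e) x b x< zero    = b zero
  snoc⁺ {suc n} k (y ∷ e) x b x< (suc j) =
    subst (λ m → lookup (e ∷ʳ x) j < suc m) (sym (+-suc k (toℕ j)))
      (snoc⁺ (suc k) e x
        (λ i → subst (λ m → lookup e i < suc m) (+-suc k (toℕ i)) (b (suc i)))
        (subst (λ m → x < suc m) (+-suc k n) x<) j)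

  snoc⁻ : ∀ {n} k (e : Vec ℕ n) x → BoundedFrom k (e ∷ʳ x) → BoundedFrom k e × x < suc (k + n)
  snoc⁻ k []      x b = (λ ()) , b zero
  snoc⁻ {suc n} k (y ∷ e) x b
    with be , x< ← snoc⁻ (suc k) e x
           (λ i → subst (λ m → lookup (e ∷ʳ x) i < suc m) (+-suc k (toℕ i)) (b (suc i)))
    = (λ { zero    → b zero
         ; (suc i) → subst (λ m → lookup e i < suc m) (sym (+-suc k (toℕ i))) (be i) })
    , subst (λ m → x < suc m) (sym (+-suc k n)) x<

  sound : ∀ n {e} → e ∈ inversionSequences n → IsInversionSequence e
  sound zero    _  ()
  sound (suc n) e∈
    with e′ , x , e′∈ , x∈ , refl ← ∈-cartesianProductWith⁻ _∷ʳ_ (inversionSequences n) (upTo (suc n)) e∈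
    = snoc⁺ 0 e′ x (sound n e′∈) (∈-upTo⁻ x∈)

  complete : ∀ n (e : Vec ℕ n) → IsInversionSequence e → e ∈ inversionSequences n
  complete zero    [] _ = here refl
  complete (suc n) e  b with e′ , x , refl ← initLast e
    with b′ , x< ← snoc⁻ 0 e′ x b
    = ∈-cartesianProductWith⁺ _∷ʳ_ (complete n e′ b′) (∈-upTo⁺ x<)

∈-inversionSequences : ∀ {n} (e : Vec ℕ n) → e ∈ inversionSequences n ⇔ IsInversionSequence e
∈-inversionSequences {n} e = mk⇔ (sound n) (complete n e)

inversionSequences-unique : ∀ n → Unique (inversionSequences n)
inversionSequences-unique zero    = All.[] ∷ []
inversionSequences-unique (suc n) =
  Unique.cartesianProductWith⁺ _∷ʳ_ (λ {w} {x} → Vec.∷ʳ-injective w x)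
    (inversionSequences-unique n) (Unique.upTo⁺ (suc n))

-- A value v of w is its i-th smallest distinct value precisely when i - 1
-- distinct values of w are smaller than v, so v is replaced by that number.
reduction : List ℕ → List ℕ
reduction w = map (λ v → length (filter (_<? v) (deduplicate _≟_ w))) w

-- Near the end of e the window is shorter than p; as reduction preserves
-- length, p then does not occur there.
OccursAt : ∀ {n} → List ℕ → Vec ℕ n → Fin n → Set
OccursAt p e j = reduction (take (length p) (drop (toℕ j) (toList e))) ≡ p

occursAt? : ∀ {n} (p : List ℕ) (e : Vec ℕ n) (j : Fin n) → Dec (OccursAt p e j)
occursAt? p e j = ≡-dec _≟_ _ p

Em : ∀ {n} → List ℕ → Vec ℕ n → Subset n
Em p e = tabulate (λ j → does (occursAt? p e j))

-- |{ e ∈ I_n : Em(p,e) = T }|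
countEm : List ℕ → (n : ℕ) → Subset n → ℕ
countEm p n T = length (filter (λ e → Vec.≡-dec _≟ᵇ_ (Em p e) T) (inversionSequences n))

SuperStronglyWilfEquivalent : List ℕ → List ℕ → Set
SuperStronglyWilfEquivalent p p′ = ∀ n (T : Subset n) → countEm p n T ≡ countEm p′ n T

-- applyUpTo suc s is the list 1, 2, …, s.
patternP : ℕ → ℕ → List ℕ
patternP r s = concatMap (λ i → replicate r 0 ++ [ i ]) (applyUpTo suc s)

patternP′ : ℕ → ℕ → List ℕ
patternP′ r s = concatMap (λ i → replicate r (i ∸ 1) ++ [ i ]) (applyUpTo suc s)

{-# OPTIONS --safe #-}

-- By inclusion–exclusion it is enough to compare, for each T, the sequences
-- whose occurrence set contains T. In both patterns a letter exceeds its left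
-- neighbour exactly at the end of a block, so two overlapping windows at
-- positions of T either have their blocks aligned or share a single letter.
-- Hence the letters of a window that distinguish the two patterns, the low
-- letters of its blocks other than the first, occupy the same place within a
-- block in every window that contains them. Erasing these letters and
-- refilling them from left to right, each from the previous block (for P) or
-- from its left neighbour (for P′), turns one pattern into the other at all
-- positions of T. The refilled values come from earlier positions, so the
-- result is an inversion sequence; and it determines the original, because the
-- erased letters are forced by the occurrences.
module Submission where

open import Defs
open import Data.Bool using (Bool; true; false)
open import Data.Bool.Properties using () renaming (_≟_ to _≟ᵇ_)
open import Data.Fin using (Fin; zero; suc; toℕ; fromℕ<)
import Data.Fin.Properties as Fin
open import Data.Fin.Subset using (Subset; _∈_; _⊆_)
open import Data.Fin.Subset.Properties using (_∈?_; _⊆?_)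
open import Data.List using (List; []; _∷_; [_]; _++_; map; concatMap; replicate; applyUpTo;
  length; take; drop; filter; deduplicate)
open import Data.List.Membership.Propositional using () renaming (_∈_ to _∈ˡ_)
open import Data.List.Membership.Propositional.Properties
  using (∈-∃++; ∈-++⁺ˡ; ∈-++⁺ʳ; ∈-++⁻; ∈-filter⁺; ∈-filter⁻; ∈-deduplicate⁺; ∈-deduplicate⁻;
         ∈-applyUpTo⁺)
open import Data.List.Properties
  using (length-++; length-replicate; length-take; length-drop; length-applyUpTo; length-map; ∷-injective)
open import Data.List.Relation.Unary.Any using (here; there)
import Data.List.Relation.Unary.All as ListAll
open import Data.List.Relation.Unary.Unique.Propositional using (Unique; []; _∷_)
import Data.List.Relation.Unary.Unique.Propositional.Properties as Unique
import Data.List.Relation.Unary.Unique.DecPropositional.Properties as DecUnique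
open import Data.Nat using (ℕ; zero; suc; _+_; _*_; _∸_; _⊓_; _≤_; _<_; z≤n; s≤s; s<s⁻¹; s≤s⁻¹; z<s; _<?_)
open import Data.Nat.DivMod using (_/_; _%_; m≡m%n+[m/n]*n; m%n<n; [m+kn]%n≡m%n; m<n⇒m%n≡m; m<n*o⇒m/o<n)
open import Data.Nat.Induction using (<-wellFounded; <-rec)
open import Data.Nat.Properties
open import Data.Nat.Tactic.RingSolver using (solve-∀)
open import Data.Product using (∃; _×_; _,_; proj₁; proj₂)
open import Data.Sum using (inj₁; inj₂)
open import Data.Vec using (Vec; []; _∷_; lookup; tabulate; toList)
import Data.Vec.Properties as Vec
open import Function using (_∘_; _⇔_; mk⇔; Equivalence)
open import Induction.WellFounded using (module FixPoint; module All)
open import Relation.Binary.Definitions using (tri<; tri≈; tri>)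
open import Relation.Binary.PropositionalEquality
  using (_≡_; refl; sym; trans; cong; cong₂; subst; subst₂; module ≡-Reasoning)
open import Relation.Nullary using (Dec; yes; no; does; ¬_; contradiction)
open import Relation.Nullary.Decidable using (map′; _×-dec_; dec-true)
open import Relation.Unary using (Pred; Decidable)
open Equivalence using (to; from)

-- Counting

-- Pigeonhole by induction: the image of the head is cut out of `ys`, and injectivity keeps the
-- images of the tail inside what remains.
length-injection : ∀ {a b} {A : Set a} {B : Set b} {xs : List A} {ys : List B} → Unique xs →
  (f : A → B) → (∀ {x} → x ∈ˡ xs → f x ∈ˡ ys) →
  (∀ {x y} → x ∈ˡ xs → y ∈ˡ xs → f x ≡ f y → x ≡ y) →
  length xs ≤ length ys
length-injection [] f f∈ f-inj = z≤n
length-injection {B = B} {xs = x ∷ xs} (x∉ ∷ uniq) f f∈ f-inj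
  with us , vs , refl ← ∈-∃++ (f∈ (here refl)) = begin
    suc (length xs)                  ≤⟨ s≤s (length-injection uniq f f∈′ (λ p q → f-inj (there p) (there q))) ⟩
    suc (length (us ++ vs))          ≡⟨ cong suc (length-++ us) ⟩
    suc (length us + length vs)      ≡⟨ +-suc (length us) (length vs) ⟨
    length us + suc (length vs)      ≡⟨ length-++ us ⟨
    length (us ++ f x ∷ vs)          ∎
  where
  open ≤-Reasoning
  f∈′ : ∀ {y} → y ∈ˡ xs → f y ∈ˡ us ++ vs
  f∈′ y∈ with ∈-++⁻ us (f∈ (there y∈))
  ... | inj₁ p         = ∈-++⁺ˡ p
  ... | inj₂ (here eq) = contradiction (f-inj (here refl) (there y∈) (sym eq)) (ListAll.lookup x∉ y∈)
  ... | inj₂ (there p) = ∈-++⁺ʳ us p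

length-filter-map : ∀ {a b p} {A : Set a} {B : Set b} {P : Pred B p} (P? : Decidable P) (f : A → B) xs →
  length (filter P? (map f xs)) ≡ length (filter (P? ∘ f) xs)
length-filter-map P? f []       = refl
length-filter-map P? f (x ∷ xs) with does (P? (f x))
... | true  = cong suc (length-filter-map P? f xs)
... | false = length-filter-map P? f xs

#equal #above : ∀ {n} → Subset n → List (Subset n) → ℕ
#equal T us = length (filter (λ u → Vec.≡-dec _≟ᵇ_ u T) us)
#above T us = length (filter (T ⊆?_) us)

tailsWithHead : ∀ {n} → Bool → List (Subset (suc n)) → List (Subset n)
tailsWithHead b     []                 = []
tailsWithHead true  ((true  ∷ u) ∷ us) = u ∷ tailsWithHead true us
tailsWithHead true  ((false ∷ u) ∷ us) = tailsWithHead true us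
tailsWithHead false ((true  ∷ u) ∷ us) = tailsWithHead false us
tailsWithHead false ((false ∷ u) ∷ us) = u ∷ tailsWithHead false us

#equal-∷ : ∀ {n} b (T : Subset n) us → #equal (b ∷ T) us ≡ #equal T (tailsWithHead b us)
#equal-∷ true  T []                 = refl
#equal-∷ false T []                 = refl
#equal-∷ true  T ((false ∷ u) ∷ us) = #equal-∷ true T us
#equal-∷ false T ((true  ∷ u) ∷ us) = #equal-∷ false T us
#equal-∷ true  T ((true  ∷ u) ∷ us) with does (Vec.≡-dec _≟ᵇ_ u T)
... | true  = cong suc (#equal-∷ true T us)
... | false = #equal-∷ true T us
#equal-∷ false T ((false ∷ u) ∷ us) with does (Vec.≡-dec _≟ᵇ_ u T)
... | true  = cong suc (#equal-∷ false T us)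
... | false = #equal-∷ false T us

#above-true : ∀ {n} (T : Subset n) us → #above (true ∷ T) us ≡ #above T (tailsWithHead true us)
#above-true T []                 = refl
#above-true T ((false ∷ u) ∷ us) = #above-true T us
#above-true T ((true  ∷ u) ∷ us) with does (T ⊆? u)
... | true  = cong suc (#above-true T us)
... | false = #above-true T us

#above-false : ∀ {n} (T : Subset n) us →
  #above (false ∷ T) us ≡ #above T (tailsWithHead true us) + #above T (tailsWithHead false us)
#above-false T []                 = refl
#above-false T ((false ∷ u) ∷ us) with does (T ⊆? u)
... | true  = trans (cong suc (#above-false T us)) (sym (+-suc _ _))
... | false = #above-false T us
#above-false T ((true  ∷ u) ∷ us) with does (T ⊆? u)
... | true  = cong suc (#above-false T us)
... | false = #above-false T us

-- Inclusion-exclusion without signs. The lists are split by the first bit of their members, and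
-- induction on `n` applies once both lists of tails are known to have the same `#above` counts.
#above-determines-#equal : ∀ {n} (us vs : List (Subset n)) →
  (∀ T → #above T us ≡ #above T vs) → ∀ T → #equal T us ≡ #equal T vs
#above-determines-#equal us vs same [] = begin
  #equal [] us  ≡⟨ []-counts us ⟩
  #above [] us  ≡⟨ same [] ⟩
  #above [] vs  ≡⟨ []-counts vs ⟨
  #equal [] vs  ∎
  where
  open ≡-Reasoning
  []-counts : ∀ us → #equal [] us ≡ #above [] us
  []-counts []        = refl
  []-counts ([] ∷ us) = cong suc ([]-counts us)
#above-determines-#equal us vs same (b ∷ T) = begin
  #equal (b ∷ T) us               ≡⟨ #equal-∷ b T us ⟩
  #equal T (tailsWithHead b us)
      ≡⟨ #above-determines-#equal (tailsWithHead b us) (tailsWithHead b vs) (same-tails b) T ⟩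
  #equal T (tailsWithHead b vs)   ≡⟨ #equal-∷ b T vs ⟨
  #equal (b ∷ T) vs               ∎
  where
  open ≡-Reasoning
  same-tails : ∀ b T → #above T (tailsWithHead b us) ≡ #above T (tailsWithHead b vs)
  same-tails true  T = trans (sym (#above-true T us)) (trans (same (true ∷ T)) (#above-true T vs))
  -- A superset of `false ∷ T` may have either first bit, so the count for `false` is obtained by
  -- cancelling the count for `true`.
  same-tails false T = +-cancelˡ-≡ (#above T (tailsWithHead true us)) _ _ (begin
    #above T (tailsWithHead true us) + #above T (tailsWithHead false us)  ≡⟨ #above-false T us ⟨
    #above (false ∷ T) us                                                 ≡⟨ same (false ∷ T) ⟩
    #above (false ∷ T) vs                                                 ≡⟨ #above-false T vs ⟩
    #above T (tailsWithHead true vs) + #above T (tailsWithHead false vs)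
      ≡⟨ cong (_+ #above T (tailsWithHead false vs)) (same-tails true T) ⟨
    #above T (tailsWithHead true us) + #above T (tailsWithHead false vs)  ∎)

-- Reduction

rank : List ℕ → ℕ → ℕ
rank w v = length (filter (_<? v) (deduplicate _≟_ w))

module _ (w : List ℕ) where

  private
    below : ℕ → List ℕ
    below v = filter (_<? v) (deduplicate _≟_ w)

    ∈-below : ∀ {u v} → u ∈ˡ w → u < v → u ∈ˡ below v
    ∈-below u∈ u<v = ∈-filter⁺ (_<? _) (∈-deduplicate⁺ _≟_ u∈) u<v

    below-∈ : ∀ {u v} → u ∈ˡ below v → u ∈ˡ w × u < v
    below-∈ u∈ with u∈′ , u<v ← ∈-filter⁻ (_<? _) u∈ = ∈-deduplicate⁻ _≟_ w u∈′ , u<v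

    below-unique : ∀ v → Unique (below v)
    below-unique v = Unique.filter⁺ (_<? v) (DecUnique.deduplicate-! _≟_ w)

  rank-mono-≤ : ∀ {u v} → u ≤ v → rank w u ≤ rank w v
  rank-mono-≤ u≤v = length-injection (below-unique _) (λ x → x)
    (λ x∈ → let x∈w , x<u = below-∈ x∈ in ∈-below x∈w (<-≤-trans x<u u≤v)) (λ _ _ eq → eq)

  rank-mono-< : ∀ {u v} → u ∈ˡ w → u < v → rank w u < rank w v
  rank-mono-< {u} {v} u∈ u<v = length-injection {xs = u ∷ below u}
    (ListAll.tabulate (λ x∈ u≡x → <-irrefl (sym u≡x) (proj₂ (below-∈ x∈))) ∷ below-unique u) (λ x → x)
    (λ { (here refl) → ∈-below u∈ u<v
       ; (there x∈)  → let x∈w , x<u = below-∈ x∈ in ∈-below x∈w (<-trans x<u u<v) })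
    (λ _ _ eq → eq)

  rank-cancel-< : ∀ {u v} → rank w u < rank w v → u < v
  rank-cancel-< lt = ≰⇒> (λ v≤u → <⇒≱ lt (rank-mono-≤ v≤u))

  rank-injective : ∀ {u v} → u ∈ˡ w → v ∈ˡ w → rank w u ≡ rank w v → u ≡ v
  rank-injective {u} {v} u∈ v∈ eq with <-cmp u v
  ... | tri< u<v _ _ = contradiction eq (<⇒≢ (rank-mono-< u∈ u<v))
  ... | tri≈ _ u≡v _ = u≡v
  ... | tri> _ _ v<u = contradiction (sym eq) (<⇒≢ (rank-mono-< v∈ v<u))

  -- The values of `w` below `f i` all occur among `f 0`, ..., `f (i - 1)`, which bounds the rank
  -- above; ranks increase strictly along `f`, which bounds it below.
  rank-enumeration : ∀ {N} (f : ℕ → ℕ) → (∀ {i j} → i < j → j ≤ N → f i < f j) →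
    (∀ {i} → i ≤ N → f i ∈ˡ w) → (∀ {v} → v ∈ˡ w → ∃ λ i → i ≤ N × v ≡ f i) →
    ∀ {i} → i ≤ N → rank w (f i) ≡ i
  rank-enumeration {N} f f-mono f∈w w∈f {i} i≤N = ≤-antisym rank≤i i≤rank
    where
    index : ∀ {v} → v ∈ˡ below (f i) → v ∈ˡ applyUpTo f i
    index v∈ with below-∈ v∈
    ... | v∈w , v<fi with w∈f v∈w
    ... | j , j≤N , refl with <-cmp j i
    ... | tri< j<i _ _  = ∈-applyUpTo⁺ f j<i
    ... | tri≈ _ refl _ = contradiction v<fi (<-irrefl refl)
    ... | tri> _ _ i<j  = contradiction v<fi (<⇒≯ (f-mono i<j j≤N))

    rank≤i : rank w (f i) ≤ i
    rank≤i = subst (rank w (f i) ≤_) (length-applyUpTo f i)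
      (length-injection (below-unique (f i)) (λ x → x) index (λ _ _ eq → eq))

    i≤rank : i ≤ rank w (f i)
    i≤rank = go i ≤-refl
      where
      go : ∀ j → j ≤ i → j ≤ rank w (f j)
      go zero    _   = z≤n
      go (suc j) j<i = ≤-<-trans (go j (<⇒≤ j<i))
        (rank-mono-< (f∈w (≤-trans (<⇒≤ j<i) i≤N)) (f-mono ≤-refl (≤-trans j<i i≤N)))

-- Segments of functions

segment : ∀ {a} {A : Set a} → (ℕ → A) → ℕ → ℕ → List A
segment h u zero    = []
segment h u (suc n) = h u ∷ segment h (suc u) n

++-injective : ∀ {a} {A : Set a} (xs ys : List A) {us vs} → length xs ≡ length ys →
  xs ++ us ≡ ys ++ vs → xs ≡ ys × us ≡ vs
++-injective []       []       _  eq = refl , eq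
++-injective (x ∷ xs) (y ∷ ys) le eq with refl , eq′ ← ∷-injective eq
  with refl , eq″ ← ++-injective xs ys (suc-injective le) eq′ = refl , eq″

module _ {a} {A : Set a} (h : ℕ → A) where

  length-segment : ∀ u n → length (segment h u n) ≡ n
  length-segment u zero    = refl
  length-segment u (suc n) = cong suc (length-segment (suc u) n)

  segment-+ : ∀ u m n → segment h u (m + n) ≡ segment h u m ++ segment h (u + m) n
  segment-+ u zero    n = cong (λ v → segment h v n) (sym (+-identityʳ u))
  segment-+ u (suc m) n = cong (h u ∷_) (trans (segment-+ (suc u) m n)
    (cong (λ v → segment h (suc u) m ++ segment h v n) (sym (+-suc u m))))

  map-segment : ∀ {b} {B : Set b} (f : A → B) u n → map f (segment h u n) ≡ segment (f ∘ h) u n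
  map-segment f u zero    = refl
  map-segment f u (suc n) = cong (f (h u) ∷_) (map-segment f (suc u) n)

  ∈-segment⁺ : ∀ u {n o} → o < n → h (u + o) ∈ˡ segment h u n
  ∈-segment⁺ u {suc n} {zero}  o<n = here (cong h (+-identityʳ u))
  ∈-segment⁺ u {suc n} {suc o} o<n =
    there (subst (λ v → h v ∈ˡ segment h (suc u) n) (sym (+-suc u o)) (∈-segment⁺ (suc u) (s<s⁻¹ o<n)))

  ∈-segment⁻ : ∀ u n {v} → v ∈ˡ segment h u n → ∃ λ o → o < n × v ≡ h (u + o)
  ∈-segment⁻ u (suc n) (here refl) = 0 , z<s , cong h (sym (+-identityʳ u))
  ∈-segment⁻ u (suc n) (there v∈) with o , o<n , refl ← ∈-segment⁻ (suc u) n v∈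
    = suc o , s≤s o<n , cong h (sym (+-suc u o))

  segment≡++⁻ : ∀ u m n xs {ys} → length xs ≡ m → segment h u (m + n) ≡ xs ++ ys →
    segment h u m ≡ xs × segment h (u + m) n ≡ ys
  segment≡++⁻ u m n xs len eq = ++-injective (segment h u m) xs
    (trans (length-segment u m) (sym len)) (trans (sym (segment-+ u m n)) eq)

  segment≡concatMap⁺ : ∀ {b} {B : Set b} (block : B → List A) (i : ℕ → B) m → ∀ u s →
    (∀ {q} → q < s → segment h (u + q * m) m ≡ block (i q)) →
    segment h u (s * m) ≡ concatMap block (applyUpTo i s)
  segment≡concatMap⁺ block i m u zero    eqs = refl
  segment≡concatMap⁺ block i m u (suc s) eqs = trans (segment-+ u m (s * m)) (cong₂ _++_
    (trans (cong (λ v → segment h v m) (sym (+-identityʳ u))) (eqs z<s))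
    (segment≡concatMap⁺ block (i ∘ suc) m (u + m) s λ {q} q<s →
      trans (cong (λ v → segment h v m) (+-assoc u m (q * m))) (eqs (s≤s q<s))))

  segment≡concatMap⁻ : ∀ {b} {B : Set b} (block : B → List A) (i : ℕ → B) m → (∀ j → length (block j) ≡ m) →
    ∀ u s → segment h u (s * m) ≡ concatMap block (applyUpTo i s) →
    ∀ {q} → q < s → segment h (u + q * m) m ≡ block (i q)
  segment≡concatMap⁻ block i m len u (suc s) eq {q} q<s
    with eq₁ , eq₂ ← segment≡++⁻ u m (s * m) (block (i 0)) (len (i 0)) eq
    with q
  ... | zero  = trans (cong (λ v → segment h v m) (+-identityʳ u)) eq₁
  ... | suc q = trans (cong (λ v → segment h v m) (sym (+-assoc u m (q * m))))
    (segment≡concatMap⁻ block (i ∘ suc) m len (u + m) s eq₂ (s<s⁻¹ q<s))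

  segment≡replicate++⁺ : ∀ u r {v x} → (∀ {c} → c < r → h (u + c) ≡ v) → h (u + r) ≡ x →
    segment h u (suc r) ≡ replicate r v ++ [ x ]
  segment≡replicate++⁺ u zero    low peak = cong [_] (trans (cong h (sym (+-identityʳ u))) peak)
  segment≡replicate++⁺ u (suc r) low peak = cong₂ _∷_ (trans (cong h (sym (+-identityʳ u))) (low z<s))
    (segment≡replicate++⁺ (suc u) r (λ {c} c<r → trans (cong h (sym (+-suc u c))) (low (s≤s c<r)))
      (trans (cong h (sym (+-suc u r))) peak))

  segment≡replicate++⁻ : ∀ u r {v x} → segment h u (suc r) ≡ replicate r v ++ [ x ] →
    (∀ {c} → c < r → h (u + c) ≡ v) × h (u + r) ≡ x
  segment≡replicate++⁻ u zero    eq = (λ ()) , trans (cong h (+-identityʳ u)) (proj₁ (∷-injective eq))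
  segment≡replicate++⁻ u (suc r) eq
    with eq₁ , eq₂ ← ∷-injective eq
    with low , peak ← segment≡replicate++⁻ (suc u) r eq₂
    = (λ { {zero}  _   → trans (cong h (+-identityʳ u)) eq₁
         ; {suc c} c<r → trans (cong h (+-suc u c)) (low (s<s⁻¹ c<r)) })
    , trans (cong h (+-suc u r)) peak

-- Vectors as functions on the natural numbers

at : ∀ {n} → Vec ℕ n → ℕ → ℕ
-- The default 0 beyond the end keeps the bound `at e i ≤ i` valid for every `i`.
at []      _       = 0
at (x ∷ e) zero    = x
at (x ∷ e) (suc i) = at e i

segment-at-∷ : ∀ {n} x (e : Vec ℕ n) u l → segment (at (x ∷ e)) (suc u) l ≡ segment (at e) u l
segment-at-∷ x e u zero    = refl
segment-at-∷ x e u (suc l) = cong (at e u ∷_) (segment-at-∷ x e (suc u) l)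

take-drop-toList : ∀ {n} (e : Vec ℕ n) u l → u + l ≤ n → take l (drop u (toList e)) ≡ segment (at e) u l
take-drop-toList e       zero    zero    _  = refl
take-drop-toList (x ∷ e) zero    (suc l) le =
  cong (x ∷_) (trans (take-drop-toList e 0 l (s≤s⁻¹ le)) (sym (segment-at-∷ x e 0 l)))
take-drop-toList (x ∷ e) (suc u) l       le =
  trans (take-drop-toList e u l (s≤s⁻¹ le)) (sym (segment-at-∷ x e u l))

lookup≡at : ∀ {n} (e : Vec ℕ n) j → lookup e j ≡ at e (toℕ j)
lookup≡at (x ∷ e) zero    = refl
lookup≡at (x ∷ e) (suc j) = lookup≡at e j

at-injective : ∀ {n} (e e′ : Vec ℕ n) → (∀ {i} → i < n → at e i ≡ at e′ i) → e ≡ e′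
at-injective []      []        eq = refl
at-injective (x ∷ e) (y ∷ e′)  eq = cong₂ _∷_ (eq z<s) (at-injective e e′ (λ i<n → eq (s≤s i<n)))

at-tabulate : ∀ {n} (h : ℕ → ℕ) {i} → i < n → at (tabulate {n = n} (h ∘ toℕ)) i ≡ h i
at-tabulate {suc n} h {zero}  _   = refl
at-tabulate {suc n} h {suc i} i<n = at-tabulate (h ∘ suc) (s<s⁻¹ i<n)

at-≤ : ∀ {n} (e : Vec ℕ n) → IsInversionSequence e → ∀ i → at e i ≤ i
at-≤ {n} e e-inv i with i <? n
... | yes i<n = subst₂ _≤_ (trans (lookup≡at e j) (cong (at e) (Fin.toℕ-fromℕ< i<n))) (Fin.toℕ-fromℕ< i<n)
    (s≤s⁻¹ (e-inv j))
  where j = fromℕ< i<n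
... | no i≮n = subst (_≤ i) (sym (at-default e (≮⇒≥ i≮n))) z≤n
  where
  at-default : ∀ {n} (e : Vec ℕ n) {i} → n ≤ i → at e i ≡ 0
  at-default []      _              = refl
  at-default (x ∷ e) (s≤s n≤i) = at-default e n≤i

-- The two patterns

data Kind : Set where
  flat stair : Kind

-- Blocks are counted from 0: block `q` consists of copies of `low κ q` followed by the peak
-- `suc q`. Thus `flat` gives P and `stair` gives P′.
low : Kind → ℕ → ℕ
low flat  q = 0
low stair q = q

low-≤ : ∀ κ q → low κ q ≤ q
low-≤ flat  q = z≤n
low-≤ stair q = ≤-refl

low-0 : ∀ κ → low κ 0 ≡ 0
low-0 κ = n≤0⇒n≡0 (low-≤ κ 0)

-- The pattern has s = suc k blocks of length m = suc r, with r = suc r′.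
module _ (r′ k : ℕ) where

  private
    r m L : ℕ
    r = suc r′
    m = suc r
    L = suc k * m

  position-< : ∀ {q c} → q ≤ k → c < m → q * m + c < L
  position-< {q} {c} q≤k c<m = begin-strict
    q * m + c  <⟨ +-monoʳ-< (q * m) c<m ⟩
    q * m + m  ≡⟨ +-comm (q * m) m ⟩
    suc q * m  ≤⟨ *-monoˡ-≤ m (s≤s q≤k) ⟩
    L          ∎
    where open ≤-Reasoning

  data Position : ℕ → Set where
    lowAt  : ∀ {q c} → q ≤ k → c < r → Position (q * m + c)
    peakAt : ∀ {q} → q ≤ k → Position (q * m + r)

  position : ∀ {o} → o < L → Position o
  position {o} o<L = subst Position
    (trans (+-comm (o / m * m) (o % m)) (sym (m≡m%n+[m/n]*n o m)))
    (split (m%n<n o m))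
    where
    q≤k : o / m ≤ k
    q≤k = s≤s⁻¹ (m<n*o⇒m/o<n {o} {suc k} {m} o<L)
    split : ∀ {c} → c < m → Position (o / m * m + c)
    split c<m with m<1+n⇒m<n∨m≡n c<m
    ... | inj₁ c<r  = lowAt q≤k c<r
    ... | inj₂ refl = peakAt q≤k

  block : Kind → ℕ → List ℕ
  block κ i = replicate r (low κ (i ∸ 1)) ++ [ i ]

  word : Kind → List ℕ
  word κ = concatMap (block κ) (applyUpTo suc (suc k))

  length-block : ∀ κ i → length (block κ i) ≡ m
  length-block κ i = begin
    length (block κ i)                             ≡⟨ length-++ (replicate r (low κ (i ∸ 1))) ⟩
    length (replicate r (low κ (i ∸ 1))) + 1       ≡⟨ cong (_+ 1) (length-replicate r) ⟩
    r + 1                                          ≡⟨ +-comm r 1 ⟩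
    m                                              ∎
    where open ≡-Reasoning

  length-word : ∀ κ → length (word κ) ≡ L
  length-word κ = go suc (suc k)
    where
    go : ∀ (i : ℕ → ℕ) s → length (concatMap (block κ) (applyUpTo i s)) ≡ s * m
    go i zero    = refl
    go i (suc s) = trans (length-++ (block κ (i 0)))
      (cong₂ _+_ (length-block κ (i 0)) (go (i ∘ suc) s))

  -- With `f` the identity this says that the window at `t` spells the word itself; with `f`
  -- increasing, that it is an order-isomorphic copy.
  Entries : Kind → (ℕ → ℕ) → (ℕ → ℕ) → ℕ → Set
  Entries κ f h t = ∀ {q} → q ≤ k →
    (∀ {c} → c < r → h (t + (q * m + c)) ≡ f (low κ q)) × h (t + (q * m + r)) ≡ f (suc q)

  segment≡word : ∀ κ g t → segment g t L ≡ word κ ⇔ Entries κ (λ v → v) g t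
  segment≡word κ g t = mk⇔
    (λ eq {q} q≤k →
      let lows , peak = segment≡replicate++⁻ g (t + q * m) r
                          (segment≡concatMap⁻ g (block κ) suc m (length-block κ) t (suc k) eq (s≤s q≤k))
      in (λ {c} c<r → trans (cong g (sym (+-assoc t (q * m) c))) (lows c<r))
       , trans (cong g (sym (+-assoc t (q * m) r))) peak)
    (λ en → segment≡concatMap⁺ g (block κ) suc m t (suc k) λ {q} q<s →
      segment≡replicate++⁺ g (t + q * m) r
        (λ {c} c<r → trans (cong g (+-assoc t (q * m) c)) (proj₁ (en (s≤s⁻¹ q<s)) c<r))
        (trans (cong g (+-assoc t (q * m) r)) (proj₂ (en (s≤s⁻¹ q<s)))))

  -- An occurrence expressed without reduction: `value i` is the entry that plays the letter `i` of
  -- the pattern, whose letters are 0, ..., `suc k`.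
  record Shape (κ : Kind) (h : ℕ → ℕ) (t : ℕ) : Set where
    field
      value      : ℕ → ℕ
      increasing : ∀ {i j} → i < j → j ≤ suc k → value i < value j
      entries    : Entries κ value h t

    lowEntry : ∀ {q c} → q ≤ k → c < r → h (t + (q * m + c)) ≡ value (low κ q)
    lowEntry q≤k = proj₁ (entries q≤k)

    peakEntry : ∀ {q} → q ≤ k → h (t + (q * m + r)) ≡ value (suc q)
    peakEntry q≤k = proj₂ (entries q≤k)

    low<peak : ∀ {q c} → q ≤ k → c < r → h (t + (q * m + c)) < h (t + (q * m + r))
    low<peak {q} q≤k c<r rewrite lowEntry q≤k c<r | peakEntry q≤k =
      increasing (s≤s (low-≤ κ q)) (s≤s q≤k)

  Shape-cong : ∀ {κ h h′ t} → (∀ {o} → o < L → h (t + o) ≡ h′ (t + o)) → Shape κ h t → Shape κ h′ t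
  Shape-cong h≗h′ S = record
    { value = value
    ; increasing = increasing
    ; entries = λ q≤k →
        (λ c<r → trans (sym (h≗h′ (position-< q≤k (m<n⇒m<1+n c<r)))) (lowEntry q≤k c<r))
      , trans (sym (h≗h′ (position-< q≤k ≤-refl))) (peakEntry q≤k)
    }
    where open Shape S

  reduction-segment : ∀ κ h t → reduction (segment h t L) ≡ word κ ⇔ Shape κ h t
  reduction-segment κ h t = mk⇔ ⇒ ⇐
    where
    w : List ℕ
    w = segment h t L

    ⇒ : reduction w ≡ word κ → Shape κ h t
    ⇒ eq = record
      { value = value
      ; increasing = λ {i} {j} i<j j≤ → rank-cancel-< w
          (subst₂ _<_ (sym (rank-value (≤-trans (<⇒≤ i<j) j≤))) (sym (rank-value j≤)) i<j)
      ; entries = λ {q} q≤k →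
          (λ c<r → rank-injective w
            (∈-segment⁺ h t (position-< q≤k (m<n⇒m<1+n c<r)))
            (value∈w (≤-trans (low-≤ κ q) (m≤n⇒m≤1+n q≤k)))
            (trans (proj₁ (ranks q≤k) c<r) (sym (rank-value (≤-trans (low-≤ κ q) (m≤n⇒m≤1+n q≤k))))))
        , refl
      }
      where
      ranks : Entries κ (λ v → v) (rank w ∘ h) t
      ranks = to (segment≡word κ (rank w ∘ h) t) (trans (sym (map-segment h (rank w) t L)) eq)

      -- For either kind the letter 0 stands at the start of the window, and the letter `suc q` is
      -- the peak of block `q`.
      value : ℕ → ℕ
      value zero    = h (t + 0)
      value (suc q) = h (t + (q * m + r))

      value∈w : ∀ {i} → i ≤ suc k → value i ∈ˡ w
      value∈w {zero}  _   = ∈-segment⁺ h t z<s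
      value∈w {suc q} q≤k = ∈-segment⁺ h t (position-< (s≤s⁻¹ q≤k) ≤-refl)

      rank-value : ∀ {i} → i ≤ suc k → rank w (value i) ≡ i
      rank-value {zero}  _   = trans (proj₁ (ranks {0} z≤n) z<s) (low-0 κ)
      rank-value {suc q} q≤k = proj₂ (ranks (s≤s⁻¹ q≤k))

    ⇐ : Shape κ h t → reduction w ≡ word κ
    ⇐ S = trans (map-segment h (rank w) t L) (from (segment≡word κ (rank w ∘ h) t) λ {q} q≤k →
        (λ c<r → trans (cong (rank w) (lowEntry q≤k c<r)) (rank-value (≤-trans (low-≤ κ q) (m≤n⇒m≤1+n q≤k))))
      , trans (cong (rank w) (peakEntry q≤k)) (rank-value (s≤s q≤k)))
      where
      open Shape S

      value∈w : ∀ {i} → i ≤ suc k → value i ∈ˡ w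
      value∈w {zero}  _   = subst (_∈ˡ w) (trans (lowEntry {0} z≤n z<s) (cong value (low-0 κ))) (∈-segment⁺ h t z<s)
      value∈w {suc q} q≤k = subst (_∈ˡ w) (peakEntry (s≤s⁻¹ q≤k)) (∈-segment⁺ h t (position-< (s≤s⁻¹ q≤k) ≤-refl))

      w∈value : ∀ {v} → v ∈ˡ w → ∃ λ i → i ≤ suc k × v ≡ value i
      w∈value v∈ with ∈-segment⁻ h t L v∈
      ... | o , o<L , refl with position o<L
      ... | lowAt {q} q≤k c<r = low κ q , ≤-trans (low-≤ κ q) (m≤n⇒m≤1+n q≤k) , lowEntry q≤k c<r
      ... | peakAt {q} q≤k    = suc q , s≤s q≤k , peakEntry q≤k

      rank-value : ∀ {i} → i ≤ suc k → rank w (value i) ≡ i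
      rank-value = rank-enumeration w value increasing value∈w w∈value

  OccursAt⇔Shape : ∀ {n} κ (e : Vec ℕ n) j →
    OccursAt (word κ) e j ⇔ (toℕ j + L ≤ n × Shape κ (at e) (toℕ j))
  OccursAt⇔Shape {n} κ e j = mk⇔
    (λ occ → let fits = window-fits occ in
      fits , to (reduction-segment κ (at e) (toℕ j)) (trans (cong reduction (sym (window fits))) occ))
    (λ (fits , S) → trans (cong reduction (window fits)) (from (reduction-segment κ (at e) (toℕ j)) S))
    where
    window : toℕ j + L ≤ n → take (length (word κ)) (drop (toℕ j) (toList e)) ≡ segment (at e) (toℕ j) L
    window fits rewrite length-word κ = take-drop-toList e (toℕ j) L fits

    window-fits : OccursAt (word κ) e j → toℕ j + L ≤ n
    window-fits occ = begin
      toℕ j + L             ≤⟨ +-monoʳ-≤ (toℕ j) (m⊓n≡m⇒m≤n L≡) ⟩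
      toℕ j + (n ∸ toℕ j)   ≡⟨ m+[n∸m]≡n (<⇒≤ (Fin.toℕ<n j)) ⟩
      n                     ∎
      where
      open ≤-Reasoning
      rest = drop (toℕ j) (toList e)
      -- Reduction preserves length, so a truncated window could not reduce to the whole word.
      L≡ : L ⊓ (n ∸ toℕ j) ≡ L
      L≡ = begin-equality
        L ⊓ (n ∸ toℕ j)                            ≡⟨ cong₂ _⊓_ (length-word κ) length-rest ⟨
        length (word κ) ⊓ length rest              ≡⟨ length-take (length (word κ)) rest ⟨
        length (take (length (word κ)) rest)       ≡⟨ length-map _ (take (length (word κ)) rest) ⟨
        length (reduction (take (length (word κ)) rest)) ≡⟨ cong length occ ⟩
        length (word κ)                            ≡⟨ length-word κ ⟩
        L                                          ∎
        where
        length-rest : length rest ≡ n ∸ toℕ j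
        length-rest = trans (length-drop (toℕ j) (toList e)) (cong (_∸ toℕ j) (Vec.length-toList e))

-- Overlapping occurrences

  -- Inside a block the left neighbour is an equal low letter; at the start of a later block it is
  -- the previous peak, which is at least as large. The bound `t ≤ i` keeps the left neighbour
  -- inside the window.
  low-not-ascent : ∀ {κ h t q c i} → Shape κ h t → q ≤ k → c < r →
    t + (q * m + c) ≡ suc i → t ≤ i → h (suc i) ≤ h i
  low-not-ascent {h = h} {t} {q} {suc c} {i} S q≤k c<r eq t≤i = ≤-reflexive (begin
    h (suc i)                ≡⟨ cong h eq ⟨
    h (t + (q * m + suc c))  ≡⟨ lowEntry q≤k c<r ⟩
    value (low _ q)          ≡⟨ lowEntry q≤k (<⇒≤ c<r) ⟨
    h (t + (q * m + c))      ≡⟨ cong h (suc-injective (trans (shift t (q * m) c) eq)) ⟩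
    h i                      ∎)
    where
    open ≡-Reasoning
    open Shape S
    shift : ∀ a b c → suc (a + (b + c)) ≡ a + (b + suc c)
    shift = solve-∀
  low-not-ascent {t = t} {zero}  {zero} S q≤k c<r eq t≤i =
    contradiction (≤-trans (≤-reflexive (trans (sym eq) (+-identityʳ t))) t≤i) (<-irrefl refl)
  low-not-ascent {κ} {h} {t} {suc q} {zero} {i} S q≤k c<r eq t≤i = begin
    h (suc i)                ≡⟨ cong h eq ⟨
    h (t + (suc q * m + 0))  ≡⟨ lowEntry q≤k c<r ⟩
    value (low κ (suc q))    ≤⟨ value-mono (low-≤ κ (suc q)) ⟩
    value (suc q)            ≡⟨ peakEntry (<⇒≤ q≤k) ⟨
    h (t + (q * m + r))      ≡⟨ cong h (suc-injective (trans (shift t q r′) eq)) ⟩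
    h i                      ∎
    where
    open ≤-Reasoning
    open Shape S
    value-mono : ∀ {i} → i ≤ suc q → value i ≤ value (suc q)
    value-mono i≤ with m≤n⇒m<n∨m≡n i≤
    ... | inj₁ i<   = <⇒≤ (increasing i< (m≤n⇒m≤1+n q≤k))
    ... | inj₂ refl = ≤-refl
    shift : ∀ t q r → suc (t + (q * suc (suc r) + suc r)) ≡ t + (suc q * suc (suc r) + 0)
    shift = solve-∀

  last-ascent : ∀ {κ h t} → Shape κ h t → h (t + (k * m + r′)) < h (t + (k * m + r))
  last-ascent S = Shape.low<peak S ≤-refl ≤-refl

  -- The last two letters of the window at `t` form an ascent, and both lie in the window at `t′`.
  -- There an ascent can only end at a peak, so the final peak of the first window is a peak of the
  -- second.
  overlap-aligned : ∀ {κ h t t′} → Shape κ h t → Shape κ h t′ → t < t′ → t′ < t + (k * m + r) →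
    ∃ λ q → t + k * m ≡ t′ + q * m
  overlap-aligned {κ} {h} {t} {t′} S S′ t<t′ t′<end = go (position o<L) refl
    where
    end o : ℕ
    end = t + (k * m + r)
    o   = end ∸ t′

    t′+o≡end : t′ + o ≡ end
    t′+o≡end = m+[n∸m]≡n (<⇒≤ t′<end)

    o<L : o < L
    o<L = begin-strict
      end ∸ t′     ≤⟨ ∸-monoʳ-≤ end (<⇒≤ t<t′) ⟩
      end ∸ t      ≡⟨ m+n∸m≡n t (k * m + r) ⟩
      k * m + r    <⟨ position-< ≤-refl ≤-refl ⟩
      L            ∎
      where open ≤-Reasoning

    end≡suc : end ≡ suc (t + (k * m + r′))
    end≡suc = trans (cong (t +_) (+-suc (k * m) r′)) (+-suc t (k * m + r′))

    go : ∀ {o′} → Position o′ → o′ ≡ o → ∃ λ q → t + k * m ≡ t′ + q * m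
    go (lowAt {q} {c} q≤k c<r) eq = contradiction
      (low-not-ascent S′ q≤k c<r (trans (trans (cong (t′ +_) eq) t′+o≡end) end≡suc)
        (s≤s⁻¹ (subst (t′ <_) end≡suc t′<end)))
      (<⇒≱ (subst (λ i → h (t + (k * m + r′)) < h i) end≡suc (last-ascent S)))
    go (peakAt {q} q≤k) eq = q , +-cancelʳ-≡ r _ _ (begin
      t + k * m + r       ≡⟨ +-assoc t (k * m) r ⟩
      end                 ≡⟨ t′+o≡end ⟨
      t′ + o              ≡⟨ cong (t′ +_) eq ⟨
      t′ + (q * m + r)    ≡⟨ +-assoc t′ (q * m) r ⟨
      t′ + q * m + r      ∎)
      where open ≡-Reasoning

  -- The first equation makes `t` and `t′` congruent modulo `m`, and the second then does the same
  -- for `c` and `c′`. The two are added crosswise so that no subtraction occurs.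
  residue-unique : ∀ {t t′ a b q q′ c c′} → t + a * m ≡ t′ + b * m →
    t + (q * m + c) ≡ t′ + (q′ * m + c′) → c < m → c′ < m → c ≡ c′
  residue-unique {t} {t′} {a} {b} {q} {q′} {c} {c′} eq eq′ c<m c′<m = begin
    c                         ≡⟨ m<n⇒m%n≡m c<m ⟨
    c % m                     ≡⟨ [m+kn]%n≡m%n c (b + q) m ⟨
    (c + (b + q) * m) % m     ≡⟨ cong (_% m) (+-cancelˡ-≡ (t + t′) _ _ sums) ⟩
    (c′ + (a + q′) * m) % m   ≡⟨ [m+kn]%n≡m%n c′ (a + q′) m ⟩
    c′ % m                    ≡⟨ m<n⇒m%n≡m c′<m ⟩
    c′                        ∎
    where
    open ≡-Reasoning
    regroup : ∀ t t′ b q c m → t + t′ + (c + (b + q) * m) ≡ (t′ + b * m) + (t + (q * m + c))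
    regroup = solve-∀
    regroup′ : ∀ t t′ a q′ c′ m → (t + a * m) + (t′ + (q′ * m + c′)) ≡ t + t′ + (c′ + (a + q′) * m)
    regroup′ = solve-∀
    sums : t + t′ + (c + (b + q) * m) ≡ t + t′ + (c′ + (a + q′) * m)
    sums = begin
      t + t′ + (c + (b + q) * m)               ≡⟨ regroup t t′ b q c m ⟩
      (t′ + b * m) + (t + (q * m + c))         ≡⟨ cong₂ _+_ (sym eq) eq′ ⟩
      (t + a * m) + (t′ + (q′ * m + c′))       ≡⟨ regroup′ t t′ a q′ c′ m ⟩
      t + t′ + (c′ + (a + q′) * m)             ∎

  -- Two windows may also share a single letter, the last of one and the first
  -- of the other; that letter is not in a low position of a non-initial block.
  overlap-residue : ∀ {κ h t t′ q q′ c c′} → Shape κ h t → Shape κ h t′ →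
    q ≤ k → c < m → q′ < k → c′ < r → t + (q * m + c) ≡ t′ + (suc q′ * m + c′) → c ≡ c′
  overlap-residue {t = t} {t′} {q} {q′} {c} {c′} S S′ q≤k c<m q′<k c′<r eq with <-cmp t t′
  ... | tri≈ _ refl _ = residue-unique {t} {t′} {0} {0} {q} {suc q′} refl eq c<m (m<n⇒m<1+n c′<r)
  ... | tri< t<t′ _ _ =
    -- The common letter lies in a non-initial block of the later window, hence strictly after `t′`,
    -- so more than one letter is shared.
    let b , aligned = overlap-aligned S S′ t<t′ (begin-strict
          t′                         <⟨ m<m+n t′ z<s ⟩
          t′ + (suc q′ * m + c′)     ≡⟨ eq ⟨
          t + (q * m + c)            ≤⟨ +-monoʳ-≤ t (s≤s⁻¹ (≤-trans (position-< q≤k c<m) (≤-reflexive L≡))) ⟩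
          t + (k * m + r)            ∎)
    in residue-unique {t} {t′} {k} {b} {q} {suc q′} aligned eq c<m (m<n⇒m<1+n c′<r)
    where
    open ≤-Reasoning
    L≡ : L ≡ suc (k * m + r)
    L≡ = trans (+-comm m (k * m)) (+-suc (k * m) r)
  ... | tri> _ _ t′<t =
    -- Here the common letter is a low letter of the earlier window, hence strictly before its final
    -- peak.
    let a , aligned = overlap-aligned S′ S t′<t (begin-strict
          t                          ≤⟨ m≤m+n t (q * m + c) ⟩
          t + (q * m + c)            ≡⟨ eq ⟩
          t′ + (suc q′ * m + c′)     <⟨ +-monoʳ-< t′ (+-mono-≤-< (*-monoˡ-≤ m q′<k) c′<r) ⟩
          t′ + (k * m + r)           ∎)
    in residue-unique {t} {t′} {a} {k} {q} {suc q′} (sym aligned) eq c<m (m<n⇒m<1+n c′<r)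
    where open ≤-Reasoning

-- Refilling

  data Altered (T : ℕ → Set) : ℕ → Set where
    altered : ∀ {t q c} → T t → q < k → c < r → Altered T (t + (suc q * m + c))

  module _ {T : ℕ → Set} {κ h} (shaped : ∀ {t} → T t → Shape κ h t) where

    -- An altered place has residue below `r` in every window that contains it, whereas a peak has
    -- residue `r`.
    peak-unaltered : ∀ {t q} → T t → q ≤ k → ¬ Altered T (t + (q * m + r))
    peak-unaltered {t} {q} Tt q≤k = go refl
      where
      go : ∀ {i} → t + (q * m + r) ≡ i → ¬ Altered T i
      go eq (altered Tt′ q′<k c′<r) =
        <-irrefl (sym (overlap-residue (shaped Tt) (shaped Tt′) q≤k ≤-refl q′<k c′<r eq)) c′<r

    -- Equal residues force the initial block at `t` to coincide with a non-initial block of another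
    -- window. Hence its low letters are altered either all together or not at all.
    altered-start : ∀ {t c} → T t → c < r → Altered T (t + c) →
      ∃ λ t′ → ∃ λ q → T t′ × q < k × t ≡ t′ + suc q * m
    altered-start {t} {c} Tt c<r = go refl
      where
      go : ∀ {i} → t + c ≡ i → Altered T i → ∃ λ t′ → ∃ λ q → T t′ × q < k × t ≡ t′ + suc q * m
      go eq (altered {t′} {q} {c′} Tt′ q<k c′<r) = t′ , q , Tt′ , q<k , +-cancelʳ-≡ c _ _ (begin
        t + c                   ≡⟨ eq ⟩
        t′ + (suc q * m + c′)   ≡⟨ cong (λ c → t′ + (suc q * m + c)) c≡c′ ⟨
        t′ + (suc q * m + c)    ≡⟨ +-assoc t′ (suc q * m) c ⟨
        t′ + suc q * m + c      ∎)
        where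
        open ≡-Reasoning
        c≡c′ : c ≡ c′
        c≡c′ = overlap-residue {q = 0} (shaped Tt) (shaped Tt′) z≤n (m<n⇒m<1+n c<r) q<k c′<r eq

  -- An altered entry copies the entry suc (skip κ) places to its left: the
  -- same place of the previous block for flat, its left neighbour for stair.
  skip : Kind → ℕ
  skip flat  = r
  skip stair = 0

  module _ {T : ℕ → Set} (altered? : Decidable (Altered T)) (κ : Kind) where

    private
      step : (h : ℕ → ℕ) (i : ℕ) → (∀ {j} → j < i → ℕ) → ℕ
      -- Position 0 is never altered, since altered letters lie in non-initial blocks.
      step h zero    rec = h zero
      step h (suc i) rec with altered? (suc i)
      -- An altered position is at least `m`, so this subtraction does not truncate.
      ... | yes _ = rec {i ∸ skip κ} (s≤s (m∸n≤m i (skip κ)))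
      ... | no  _ = h (suc i)

      step-ext : ∀ h i {rec rec′ : ∀ {j} → j < i → ℕ} → (∀ {j} (j<i : j < i) → rec j<i ≡ rec′ j<i) →
        step h i rec ≡ step h i rec′
      step-ext h zero    ext = refl
      step-ext h (suc i) ext with altered? (suc i)
      ... | yes _ = ext _
      ... | no  _ = refl

      module Rec h = FixPoint <-wellFounded (λ _ → ℕ) (step h) (step-ext h)

    -- What is copied is the refilled entry rather than the original one, so values travel through
    -- successive blocks and overlapping windows.
    refill : (ℕ → ℕ) → ℕ → ℕ
    refill h = All.wfRec <-wellFounded _ (λ _ → ℕ) (step h)

    refill-unaltered : ∀ h {i} → ¬ Altered T i → refill h i ≡ h i
    refill-unaltered h {zero}  ¬a = Rec.unfold-wfRec h {zero}
    refill-unaltered h {suc i} ¬a = trans (Rec.unfold-wfRec h {suc i}) kept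
      where
      kept : step h (suc i) (λ {j} _ → refill h j) ≡ h (suc i)
      kept with altered? (suc i)
      ... | yes a = contradiction a ¬a
      ... | no  _ = refl

    refill-altered : ∀ h {i j} → Altered T i → i ≡ suc (skip κ + j) → refill h i ≡ refill h j
    refill-altered h {j = j} a refl = trans (Rec.unfold-wfRec h {suc (skip κ + j)}) copied
      where
      copied : step h (suc (skip κ + j)) (λ {j} _ → refill h j) ≡ refill h j
      copied with altered? (suc (skip κ + j))
      ... | yes _ = cong (refill h) (m+n∸m≡n (skip κ) j)
      ... | no ¬a = contradiction a ¬a

    refill-≤ : ∀ h → (∀ i → h i ≤ i) → ∀ i → refill h i ≤ i
    refill-≤ h h≤ = <-rec (λ i → refill h i ≤ i) λ
      { zero    rec → ≤-trans (≤-reflexive (Rec.unfold-wfRec h {zero})) (h≤ zero)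
      ; (suc i) rec → ≤-trans (≤-reflexive (Rec.unfold-wfRec h {suc i})) (bound i rec) }
      where
      bound : ∀ i → (∀ {j} → j < suc i → refill h j ≤ j) → step h (suc i) (λ {j} _ → refill h j) ≤ suc i
      bound i rec with altered? (suc i)
      ... | yes _ = ≤-trans (rec (s≤s (m∸n≤m i (skip κ)))) (m≤n⇒m≤1+n (m∸n≤m i (skip κ)))
      ... | no  _ = h≤ (suc i)

  module _ {T : ℕ → Set} (altered? : Decidable (Altered T)) {κ h} (shaped : ∀ {t} → T t → Shape κ h t) where

    refill-low-flat : ∀ {t q c} → T t → q < k → c < r →
      refill altered? flat h (t + (suc q * m + c)) ≡ refill altered? flat h (t + (q * m + c))
    refill-low-flat {t} {q} {c} Tt q<k c<r = refill-altered altered? flat h (altered Tt q<k c<r) (shift t q r c)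
      where
      shift : ∀ t q r c → t + (suc q * suc r + c) ≡ suc (r + (t + (q * suc r + c)))
      shift = solve-∀

    refill-low-stair-suc : ∀ {t q c} → T t → q < k → suc c < r →
      refill altered? stair h (t + (suc q * m + suc c)) ≡ refill altered? stair h (t + (suc q * m + c))
    refill-low-stair-suc {t} {q} {c} Tt q<k c<r =
      refill-altered altered? stair h (altered Tt q<k c<r) (shift t (suc q * m) c)
      where
      shift : ∀ a b c → a + (b + suc c) ≡ suc (a + (b + c))
      shift = solve-∀

    refill-low-stair-zero : ∀ {t q} → T t → q < k →
      refill altered? stair h (t + (suc q * m + 0)) ≡ refill altered? stair h (t + (q * m + r))
    refill-low-stair-zero {t} {q} Tt q<k = refill-altered altered? stair h (altered Tt q<k z<s) (shift t q r)
      where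
      shift : ∀ t q r → t + (suc q * suc r + 0) ≡ suc (t + (q * suc r + r))
      shift = solve-∀

    refill-peak : ∀ κ′ {t q} → T t → q ≤ k → refill altered? κ′ h (t + (q * m + r)) ≡ h (t + (q * m + r))
    refill-peak κ′ Tt q≤k = refill-unaltered altered? κ′ h (peak-unaltered shaped Tt q≤k)

    module _ (κ′ : Kind) where

      private
        h′ : ℕ → ℕ
        h′ = refill altered? κ′ h

      -- The one part of a window that the window's own refilling leaves alone; it may still be
      -- altered on account of another window.
      InitialBlock : ℕ → Set
      InitialBlock t = ∃ λ v → (∀ {c} → c < r → h′ (t + c) ≡ v) × v < h′ (t + r)

      initialBlock-unaltered : ∀ {t} → T t → ¬ Altered T t → InitialBlock t
      initialBlock-unaltered {t} Tt ¬a =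
        value (low κ 0) , (λ c<r → trans (unchanged c<r) (lowEntry z≤n c<r)) ,
        subst₂ _<_ (lowEntry {0} z≤n z<s) (sym (refill-peak κ′ Tt z≤n)) (low<peak {0} z≤n z<s)
        where
        open Shape (shaped Tt)
        unchanged : ∀ {c} → c < r → h′ (t + c) ≡ h (t + c)
        unchanged c<r = refill-unaltered altered? κ′ h λ a →
          let t′ , q , Tt′ , q<k , t≡ = altered-start shaped Tt c<r a
          in ¬a (subst (Altered T) (trans (cong (t′ +_) (+-identityʳ (suc q * m))) (sym t≡)) (altered Tt′ q<k z<s))

      -- The initial block of an altered t is a later block of an earlier window.
      initialBlock-altered : ∀ {t′ q} → q < k → Shape κ′ h′ t′ → InitialBlock (t′ + suc q * m)
      initialBlock-altered {t′} {q} q<k S =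
        value (low κ′ (suc q)) ,
        (λ {c} c<r → trans (cong h′ (+-assoc t′ (suc q * m) c)) (lowEntry q<k c<r)) ,
        subst₂ _<_ (lowEntry q<k z<s) (cong h′ (sym (+-assoc t′ (suc q * m) r))) (low<peak q<k z<s)
        where open Shape S

      -- Peaks are unaltered, so their order is inherited from `h`. Refilling then carries `v` from
      -- block to block for `flat`, and each peak through the block after it for `stair`.
      extend-initialBlock : ∀ {t} → T t → InitialBlock t → Shape κ′ h′ t
      extend-initialBlock {t} Tt (v , lows , v<peak) = record
        { value = value
        ; increasing = increasing
        ; entries = λ q≤k → low-entry κ′ refl _ _ q≤k , refl
        }
        where
        value : ℕ → ℕ
        value zero    = v
        value (suc q) = h′ (t + (q * m + r))

        peaks-increasing : ∀ {p q} → p < q → q ≤ k → value (suc p) < value (suc q)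
        peaks-increasing {p} {q} p<q q≤k = subst₂ _<_
          (trans (sym (peakEntry p≤k)) (sym (refill-peak κ′ Tt p≤k)))
          (trans (sym (peakEntry q≤k)) (sym (refill-peak κ′ Tt q≤k)))
          (Shape.increasing (shaped Tt) (s≤s p<q) (s≤s q≤k))
          where
          open Shape (shaped Tt) using (peakEntry)
          p≤k = ≤-trans (<⇒≤ p<q) q≤k

        increasing : ∀ {i j} → i < j → j ≤ suc k → value i < value j
        increasing {zero}  {suc zero}    _   _ = v<peak
        increasing {zero}  {suc (suc q)} _   j≤ = <-trans v<peak (peaks-increasing z<s (s≤s⁻¹ j≤))
        increasing {suc p} {suc q}       i<j j≤ = peaks-increasing (s<s⁻¹ i<j) (s≤s⁻¹ j≤)

        -- κ′ is a module parameter, so it is matched on through a copy.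
        low-entry : ∀ κ″ → κ″ ≡ κ′ → ∀ q c → q ≤ k → c < r → h′ (t + (q * m + c)) ≡ value (low κ′ q)
        low-entry κ″    refl zero    c       _   c<r = trans (lows c<r) (cong value (sym (low-0 κ′)))
        low-entry flat  refl (suc q) c       q<k c<r =
          trans (refill-low-flat Tt q<k c<r) (low-entry flat refl q c (<⇒≤ q<k) c<r)
        low-entry stair refl (suc q) zero    q<k c<r = refill-low-stair-zero Tt q<k
        low-entry stair refl (suc q) (suc c) q<k c<r =
          trans (refill-low-stair-suc Tt q<k c<r) (low-entry stair refl (suc q) c q<k (<⇒≤ c<r))

      -- Strong induction on the position: if `t` is altered, its initial block belongs to a window
      -- further left, whose shape is already known.
      refill-Shape : ∀ t → T t → Shape κ′ h′ t
      refill-Shape = <-rec (λ t → T t → Shape κ′ h′ t) λ t rec Tt → extend-initialBlock Tt (initialBlock rec Tt)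
        where
        initialBlock : ∀ {t} → (∀ {t′} → t′ < t → T t′ → Shape κ′ h′ t′) → T t → InitialBlock t
        initialBlock {t} rec Tt with altered? t
        ... | no ¬a = initialBlock-unaltered Tt ¬a
        ... | yes a with altered-start shaped {c = 0} Tt z<s (subst (Altered T) (sym (+-identityʳ t)) a)
        ... | t′ , q , Tt′ , q<k , refl = initialBlock-altered q<k (rec (m<m+n t′ z<s) Tt′)

  -- Recovering the original entries

  source : Kind → ℕ → ℕ
  source flat  q = 0
  source stair q = q * m + r

  source-< : ∀ κ q c → source κ q < suc q * m + c
  source-< flat  q c = z<s
  source-< stair q c = begin-strict
    q * m + r        <⟨ +-monoʳ-< (q * m) ≤-refl ⟩
    q * m + m        ≡⟨ +-comm (q * m) m ⟩
    suc q * m        ≤⟨ m≤m+n (suc q * m) c ⟩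
    suc q * m + c    ∎
    where open ≤-Reasoning

  -- In the original pattern the low letters of a later block repeat the first letter of the window
  -- for `flat` and the preceding peak for `stair`.
  Shape-source : ∀ {κ h t q c} → Shape κ h t → q < k → c < r → h (t + (suc q * m + c)) ≡ h (t + source κ q)
  Shape-source {flat}  S q<k c<r = trans (Shape.lowEntry S q<k c<r) (sym (Shape.lowEntry S {0} z≤n z<s))
  Shape-source {stair} S q<k c<r = trans (Shape.lowEntry S q<k c<r) (sym (Shape.peakEntry S (<⇒≤ q<k)))

  -- Induction from left to right: an unaltered entry survives in the refilling, and an altered one
  -- equals, in both originals, the entry at the same earlier position.
  refill-injective : ∀ {T : ℕ → Set} (altered? : Decidable (Altered T)) {κ h₁ h₂} κ′ →
    (∀ {t} → T t → Shape κ h₁ t) → (∀ {t} → T t → Shape κ h₂ t) →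
    ∀ {n} → (∀ {i} → i < n → refill altered? κ′ h₁ i ≡ refill altered? κ′ h₂ i) →
    ∀ i → i < n → h₁ i ≡ h₂ i
  refill-injective {T} altered? {κ} {h₁} {h₂} κ′ shaped₁ shaped₂ {n} eq =
    <-rec (λ i → i < n → h₁ i ≡ h₂ i) (λ _ → go)
    where
    go : ∀ {i} → (∀ {j} → j < i → j < n → h₁ j ≡ h₂ j) → i < n → h₁ i ≡ h₂ i
    go {i} rec i<n with altered? i
    ... | no ¬a = trans (sym (refill-unaltered altered? κ′ h₁ ¬a))
                    (trans (eq i<n) (refill-unaltered altered? κ′ h₂ ¬a))
    ... | yes (altered {t} {q} {c} Tt q<k c<r) =
      trans (Shape-source (shaped₁ Tt) q<k c<r)
        (trans (rec source<i (<-trans source<i i<n)) (sym (Shape-source (shaped₂ Tt) q<k c<r)))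
      where
      source<i : t + source κ q < t + (suc q * m + c)
      source<i = +-monoʳ-< t (source-< κ q c)

  -- The injection between inversion sequences

  module _ {n} (T : Subset n) where

    Marked : ℕ → Set
    Marked t = ∃ λ j → j ∈ T × toℕ j ≡ t

    altered? : Decidable (Altered Marked)
    altered? i = map′
      (λ { (j , j∈T , q , c , refl) → altered (j , j∈T , refl) (Fin.toℕ<n q) (Fin.toℕ<n c) })
      encode
      (Fin.any? λ j → j ∈? T ×-dec Fin.any? λ q → Fin.any? λ c → toℕ j + (suc (toℕ q) * m + toℕ c) ≟ i)
      where
      encode : ∀ {i} → Altered Marked i →
        ∃ λ j → j ∈ T × ∃ λ (q : Fin k) → ∃ λ (c : Fin r) → toℕ j + (suc (toℕ q) * m + toℕ c) ≡ i
      encode (altered (j , j∈T , refl) q<k c<r) = j , j∈T , fromℕ< q<k , fromℕ< c<r ,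
        cong₂ (λ q c → toℕ j + (suc q * m + c)) (Fin.toℕ-fromℕ< q<k) (Fin.toℕ-fromℕ< c<r)

    -- The altered positions depend on `T` alone, not on `e`, so all sequences are erased at the
    -- same places.
    transform : Kind → Vec ℕ n → Vec ℕ n
    transform κ e = tabulate (refill altered? κ (at e) ∘ toℕ)

    ∈-Em : ∀ p (e : Vec ℕ n) j → j ∈ Em p e ⇔ OccursAt p e j
    ∈-Em p e j = mk⇔
      (λ j∈ → dec⁻ (occursAt? p e j) (trans (sym (Vec.lookup∘tabulate _ j)) (Vec.[]=⇒lookup j∈)))
      (λ occ → Vec.lookup⇒[]= j _ (trans (Vec.lookup∘tabulate _ j) (dec-true (occursAt? p e j) occ)))
      where
      dec⁻ : ∀ {A : Set} (A? : Dec A) → does A? ≡ true → A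
      dec⁻ (yes a) _ = a

    module _ {κ} {e : Vec ℕ n} (T⊆Em : T ⊆ Em (word κ) e) where

      marked-fits : ∀ {j} → j ∈ T → toℕ j + L ≤ n
      marked-fits {j} j∈T = proj₁ (to (OccursAt⇔Shape κ e j) (to (∈-Em (word κ) e j) (T⊆Em j∈T)))

      marked-Shape : ∀ {t} → Marked t → Shape κ (at e) t
      marked-Shape (j , j∈T , refl) = proj₂ (to (OccursAt⇔Shape κ e j) (to (∈-Em (word κ) e j) (T⊆Em j∈T)))

      transform-⊆ : ∀ κ′ → T ⊆ Em (word κ′) (transform κ′ e)
      transform-⊆ κ′ {j} j∈T = from (∈-Em (word κ′) (transform κ′ e) j)
        (from (OccursAt⇔Shape κ′ (transform κ′ e) j)
        ( marked-fits j∈T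
        -- The tabulated vector agrees with the refilled function below `n`, and a marked window
        -- ends there.
        , Shape-cong (λ o<L → sym (at-tabulate (refill altered? κ′ (at e))
              (<-≤-trans (+-monoʳ-< (toℕ j) o<L) (marked-fits j∈T))))
            (refill-Shape altered? marked-Shape κ′ (toℕ j) (j , j∈T , refl))))

    transform-injective : ∀ {κ} κ′ {e e′} → T ⊆ Em (word κ) e → T ⊆ Em (word κ) e′ →
      transform κ′ e ≡ transform κ′ e′ → e ≡ e′
    transform-injective κ′ {e} {e′} T⊆ T⊆′ eq = at-injective e e′ λ {i} i<n →
      refill-injective altered? κ′ (marked-Shape T⊆) (marked-Shape T⊆′)
        (λ i<n → trans (sym (at-tabulate _ i<n)) (trans (cong (λ e → at e _) eq) (at-tabulate _ i<n))) i i<n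

    transform-inversion : ∀ κ e → IsInversionSequence e → IsInversionSequence (transform κ e)
    transform-inversion κ e e-inv j = s≤s (≤-trans (≤-reflexive (Vec.lookup∘tabulate _ j))
      (refill-≤ altered? κ (at e) (at-≤ e e-inv) (toℕ j)))

    -- Since both kinds are arbitrary, exchanging them gives the reverse inequality, and equality
    -- follows without an inverse map.
    #above-≤ : ∀ κ κ′ → #above T (map (Em (word κ)) (inversionSequences n)) ≤
                        #above T (map (Em (word κ′)) (inversionSequences n))
    #above-≤ κ κ′ = subst₂ _≤_ (sym (length-filter-map (T ⊆?_) (Em (word κ)) (inversionSequences n)))
        (sym (length-filter-map (T ⊆?_) (Em (word κ′)) (inversionSequences n)))
        (length-injection (Unique.filter⁺ (contains? κ) (inversionSequences-unique n)) (transform κ′) transform-∈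
          (λ e∈ e′∈ → transform-injective κ′ (contains e∈) (contains e′∈)))
      where
      contains? : ∀ κ → Decidable (λ (e : Vec ℕ n) → T ⊆ Em (word κ) e)
      contains? κ e = T ⊆? Em (word κ) e
      contains : ∀ {e} → e ∈ˡ filter (contains? κ) (inversionSequences n) → T ⊆ Em (word κ) e
      contains e∈ = proj₂ (∈-filter⁻ (contains? κ) {xs = inversionSequences n} e∈)
      transform-∈ : ∀ {e} → e ∈ˡ filter (contains? κ) (inversionSequences n) →
        transform κ′ e ∈ˡ filter (contains? κ′) (inversionSequences n)
      transform-∈ {e} e∈ with e∈I , T⊆ ← ∈-filter⁻ (contains? κ) {xs = inversionSequences n} e∈ =
        ∈-filter⁺ (contains? κ′)
          (from (∈-inversionSequences (transform κ′ e)) (transform-inversion κ′ e (to (∈-inversionSequences e) e∈I)))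
          (transform-⊆ T⊆ κ′)

  words-equivalent : ∀ κ κ′ → SuperStronglyWilfEquivalent (word κ) (word κ′)
  words-equivalent κ κ′ n T = begin
    countEm (word κ) n T                    ≡⟨ length-filter-map _ (Em (word κ)) I ⟨
    #equal T (map (Em (word κ)) I)
      ≡⟨ #above-determines-#equal (map (Em (word κ)) I) (map (Em (word κ′)) I)
           (λ T → ≤-antisym (#above-≤ T κ κ′) (#above-≤ T κ′ κ)) T ⟩
    #equal T (map (Em (word κ′)) I)         ≡⟨ length-filter-map _ (Em (word κ′)) I ⟩
    countEm (word κ′) n T                   ∎
    where
    open ≡-Reasoning
    I = inversionSequences n

mainTheorem6 : (r s : ℕ) → 1 ≤ r → 2 ≤ s → SuperStronglyWilfEquivalent (patternP r s) (patternP′ r s)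
-- `word r′ k flat` and `word r′ k stair` compute to the two patterns.
mainTheorem6 (suc r′) (suc k) _ _ = words-equivalent r′ k flat stair
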